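{- Let $p$ and $c$ be integers with $p \geq 1$ and $c \geq 3$. Let $G=(V,E)$ be a $1$-FT($pK_c$) graph with $|V|=pc+1$. If $|E| \leq \binom{c+1}{2} p$, then every block of $G$ is isomorphic to $K_{c+1}$.
   Context: All graphs are finite, simple and undirected. For integers $k\ge 0$, $p\ge 1$, $c\ge 2$, a graph $G=(V,E)$ is called $k$-FT($pK_c$) if for every $S\subset V$ with $|S|\le k$, the graph $G-S$ contains as a subgraph the disjoint union of $p$ complete graphs $K_c$. A block of a graph is a maximal connected subgraph without a cutvertex. -}

module Defs where

open import Data.Nat using (ℕ; zero; suc; _+_; _*_; _≤_; _<ᵇ_)
open import Data.Bool using (Bool; true; false; _∧_; if_then_else_)
open import Data.Fin using (Fin; toℕ)
open import Data.Fin.Subset using (Subset; _∈_; _∉_; ∣_∣)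
open import Data.List using (List; map; allFin)
open import Data.Nat.ListAction using (sum)
open import Data.Product using (Σ; ∃; ∃-syntax; _×_; _,_)
open import Relation.Binary.PropositionalEquality using (_≡_; _≢_)
open import Relation.Nullary using (¬_)
open import Data.Unit using (⊤)
open import Function.Bundles using (_⇔_)

record Graph (n : ℕ) : Set where
  field
    adj    : Fin n → Fin n → Bool
    sym    : ∀ i j → adj i j ≡ adj j i
    irrefl : ∀ i → adj i i ≡ false
open Graph public

edgeCount : ∀ {n} → Graph n → ℕ
edgeCount {n} G =
  sum (map (λ i → sum (map (λ j → if adj G i j ∧ (toℕ i <ᵇ toℕ j) then 1 else 0)
                               (allFin n)))
           (allFin n))

ContainsPKcAvoiding : ∀ {n} → Graph n → (p c : ℕ) → Subset n → Set
ContainsPKcAvoiding {n} G p c S =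
  Σ (Fin p → Fin c → Fin n) λ f →
      (∀ a b x y → f a x ≡ f b y → (a ≡ b × x ≡ y))
    × (∀ a x → f a x ∉ S)
    × (∀ a x y → x ≢ y → adj G (f a x) (f a y) ≡ true)

FT : ∀ {n} → (k p c : ℕ) → Graph n → Set
FT {n} k p c G = ∀ (S : Subset n) → ∣ S ∣ ≤ k → ContainsPKcAvoiding G p c S

record Subgraph {n : ℕ} (G : Graph n) : Set where
  field
    vs     : Subset n
    es     : Fin n → Fin n → Bool
    es-sym : ∀ i j → es i j ≡ es j i
    es-adj : ∀ i j → es i j ≡ true → adj G i j ≡ true
    es-vs  : ∀ i j → es i j ≡ true → (i ∈ vs × j ∈ vs)
open Subgraph public

data WalkIn {n} {G : Graph n} (H : Subgraph G) (P : Fin n → Set) : Fin n → Fin n → Set where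
  here : ∀ {x} → x ∈ vs H → P x → WalkIn H P x x
  step : ∀ {x y z} → x ∈ vs H → P x → es H x y ≡ true → WalkIn H P y z → WalkIn H P x z

Walk : ∀ {n} {G : Graph n} → Subgraph G → Fin n → Fin n → Set
Walk H x y = WalkIn H (λ _ → ⊤) x y

WalkAvoid : ∀ {n} {G : Graph n} → Subgraph G → Fin n → Fin n → Fin n → Set
WalkAvoid H v x y = WalkIn H (λ u → u ≢ v) x y

Connected : ∀ {n} {G : Graph n} → Subgraph G → Set
Connected {n} H = (∃[ x ] x ∈ vs H) × (∀ x y → x ∈ vs H → y ∈ vs H → Walk H x y)

-- v is a cutvertex of H: removing v increases the number of components,
-- i.e. two vertices other than v connected in H become disconnected in H - v.
Cutvertex : ∀ {n} {G : Graph n} → Subgraph G → Fin n → Set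
Cutvertex {n} H v =
  v ∈ vs H × ∃[ x ] ∃[ y ] (x ∈ vs H × y ∈ vs H × x ≢ v × y ≢ v
                             × Walk H x y × ¬ WalkAvoid H v x y)

NoCutvertex : ∀ {n} {G : Graph n} → Subgraph G → Set
NoCutvertex H = ∀ v → ¬ Cutvertex H v

_⊑_ : ∀ {n} {G : Graph n} → Subgraph G → Subgraph G → Set
_⊑_ {n} H H' = (∀ x → x ∈ vs H → x ∈ vs H') × (∀ i j → es H i j ≡ true → es H' i j ≡ true)

IsBlock : ∀ {n} {G : Graph n} → Subgraph G → Set
IsBlock {n} {G} H =
  Connected H × NoCutvertex H ×
  (∀ (H' : Subgraph G) → H ⊑ H' → Connected H' → NoCutvertex H' → H' ⊑ H)

IsoComplete : ∀ {n} {G : Graph n} → Subgraph G → ℕ → Set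
IsoComplete {n} H m =
  Σ (Fin m → Fin n) λ f →
      (∀ x y → f x ≡ f y → x ≡ y)
    × (∀ x → f x ∈ vs H)
    × (∀ v → v ∈ vs H → ∃[ x ] f x ≡ v)
    × (∀ x y → (es H (f x) (f y) ≡ true) ⇔ (x ≢ y))

{-# OPTIONS --safe #-}

-- A vertex u of degree c lies in a (c+1)-clique: deleting one neighbour forces the
-- other ones into the c-clique of u, and c ≥ 3 makes every two neighbours adjacent.
-- Contracting the clique N[u] gives a fault-tolerant graph for p - 1 with at least c(c+1)/2
-- fewer edges and the same degrees outside N[u], provided multiplicities are kept;
-- this is why the induction runs over multigraphs.  By averaging, a vertex of degree c
-- always exists, so by induction there is a leaf: a clique N[u] all of whose vertices
-- but one, r, have degree c.  The leaf can moreover be chosen so that a given vertex is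
-- not among those of degree c, and this is what allows it to be lifted through the
-- contraction.  Now let H be connected without cutvertex.  If H meets a leaf outside r,
-- then H lies in the leaf, because r separates it from the rest; otherwise delete the
-- leaf except r and induct.  Hence H lies in a (c+1)-clique, and a block equals it.

module Submission where

open import Defs renaming (sym to adj-sym)
open import Data.Bool using (true; _∧_; if_then_else_)
import Data.Bool as Bool
open import Data.Bool.Properties using (T-≡)
open import Data.Fin using (Fin; zero; suc; toℕ; remQuot; combine)
open import Data.Fin.Permutation using (Permutation; transpose; inverseˡ; _⟨$⟩ʳ_; _⟨$⟩ˡ_)
open import Data.Fin.Properties using (_≟_; any?; toℕ-injective; combine-remQuot; injective⇒≤; suc-injective)
open import Data.Fin.Subset using (Subset; _∈_; ⁅_⁆)
open import Data.Fin.Subset.Properties using (_∈?_; x∈⁅x⁆; ∣⁅x⁆∣≡1)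
import Data.List as List
open import Data.List.Properties using (map-tabulate)
open import Data.Nat using (ℕ; zero; suc; _+_; _*_; _≤_; _<_; z≤n; s≤s; _≤?_; _<?_; _<ᵇ_)
import Data.Nat as ℕ
open import Data.Nat.Combinatorics using (_C_; nC1≡n; nCk+nC[k+1]≡[n+1]C[k+1])
import Data.Nat.ListAction as ListAction
open import Data.Nat.Properties hiding (_≟_; suc-injective)
open import Data.Nat.Tactic.RingSolver using (solve-∀)
open import Data.Product using (∃; ∃-syntax; _×_; _,_; proj₁; proj₂)
open import Data.Sum using (_⊎_; inj₁; inj₂)
open import Data.Unit using (⊤; tt)
open import Data.Vec using (tabulate)
open import Data.Vec.Properties using (lookup∘tabulate; lookup⇒[]=; []=⇒lookup)
open import Function using (_∘_)
open import Function.Bundles using (Equivalence; mk⇔)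
open import Relation.Binary using (Tri; tri<; tri≈; tri>)
open import Relation.Binary.PropositionalEquality using (_≡_; _≢_; refl; sym; trans; cong; cong₂; subst)
open import Relation.Nullary using (¬_; Dec; yes; no; does; contradiction; ¬?; _×-dec_; _⊎-dec_)
open import Relation.Nullary.Decidable using (dec-true; dec-false; does-⇔)
open import Algebra.Properties.Semiring.Sum +-*-semiring using (sum; sum-cong-≗; ∑-distrib-+; ∑-comm; sum-permute; *-distribˡ-sum; *-distribʳ-sum)

private
  variable
    n : ℕ
    P Q : Set

-- Finite sums of natural numbers

sum-mono : {f g : Fin n → ℕ} → (∀ i → f i ≤ g i) → sum f ≤ sum g
sum-mono {zero}  f≤g = z≤n
sum-mono {suc n} f≤g = +-mono-≤ (f≤g zero) (sum-mono (f≤g ∘ suc))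

sum<sum⇒∃< : {f g : Fin n → ℕ} → sum f < sum g → ∃[ i ] f i < g i
sum<sum⇒∃< {f = f} {g} lt with any? (λ i → f i <? g i)
... | yes found = found
... | no ¬found = contradiction (sum-mono (λ i → ≮⇒≥ (λ fi<gi → ¬found (i , fi<gi)))) (<⇒≱ lt)

sum-tight : {f g : Fin n → ℕ} → (∀ i → f i ≤ g i) → sum g ≤ sum f → ∀ i → f i ≡ g i
sum-tight {suc n} {f} {g} f≤g ∑g≤∑f zero = ≤-antisym (f≤g zero)
  (+-cancelʳ-≤ _ _ _ (≤-trans ∑g≤∑f (+-monoʳ-≤ (f zero) (sum-mono (f≤g ∘ suc)))))
sum-tight {suc n} {f} {g} f≤g ∑g≤∑f (suc i) = sum-tight (f≤g ∘ suc)
  (+-cancelˡ-≤ (g zero) _ _ (≤-trans ∑g≤∑f (+-monoˡ-≤ _ (f≤g zero)))) i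

sum-zero : {f : Fin n → ℕ} → (∀ i → f i ≡ 0) → sum f ≡ 0
sum-zero {zero}  f≡0 = refl
sum-zero {suc n} f≡0 = cong₂ _+_ (f≡0 zero) (sum-zero (f≡0 ∘ suc))

sum-concentrated : {f : Fin n → ℕ} (x : Fin n) → (∀ y → y ≢ x → f y ≡ 0) → sum f ≡ f x
sum-concentrated {suc n} {f} zero f≡0 =
  trans (cong (f zero +_) (sum-zero (λ i → f≡0 (suc i) λ ()))) (+-identityʳ _)
sum-concentrated {suc n} {f} (suc x) f≡0 =
  cong₂ _+_ (f≡0 zero λ ()) (sum-concentrated x (λ y y≢x → f≡0 (suc y) λ { refl → y≢x refl }))

term≤sum : (f : Fin n → ℕ) (i : Fin n) → f i ≤ sum f
term≤sum f zero    = m≤m+n _ _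
term≤sum f (suc i) = ≤-trans (term≤sum (f ∘ suc) i) (m≤n+m _ _)

terms≤sum : (f : Fin n → ℕ) {i j : Fin n} → i ≢ j → f i + f j ≤ sum f
terms≤sum f {zero}  {zero}  i≢j = contradiction refl i≢j
terms≤sum f {zero}  {suc j} i≢j = +-monoʳ-≤ (f zero) (term≤sum (f ∘ suc) j)
terms≤sum f {suc i} {zero}  i≢j =
  ≤-trans (≤-reflexive (+-comm (f (suc i)) _)) (+-monoʳ-≤ (f zero) (term≤sum (f ∘ suc) i))
terms≤sum f {suc i} {suc j} i≢j = ≤-trans (terms≤sum (f ∘ suc) (i≢j ∘ cong suc)) (m≤n+m _ _)

sum-positive : {f : Fin n → ℕ} → 1 ≤ sum f → ∃[ i ] 1 ≤ f i
sum-positive {n} {f} pos =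
  sum<sum⇒∃< {f = λ _ → 0} (≤-trans (≤-reflexive (cong suc (sum-zero {n} (λ _ → refl)))) pos)

-- Indicators and counting.

𝟙 : Dec P → ℕ
𝟙 (yes _) = 1
𝟙 (no _)  = 0

𝟙-true : (d : Dec P) → P → 𝟙 d ≡ 1
𝟙-true (yes _) p = refl
𝟙-true (no ¬p) p = contradiction p ¬p

𝟙-false : (d : Dec P) → ¬ P → 𝟙 d ≡ 0
𝟙-false (yes p) ¬p = contradiction p ¬p
𝟙-false (no _)  ¬p = refl

𝟙-pos : {d : Dec P} → 1 ≤ 𝟙 d → P
𝟙-pos {d = yes p} _ = p

𝟙≤1 : (d : Dec P) → 𝟙 d ≤ 1
𝟙≤1 (yes _) = ≤-refl
𝟙≤1 (no _)  = z≤n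

𝟙-≤ : {m : ℕ} (d : Dec P) → (P → 1 ≤ m) → 𝟙 d ≤ m
𝟙-≤ (yes p) h = h p
𝟙-≤ (no _)  h = z≤n

𝟙-cong : (d : Dec P) (d′ : Dec Q) → (P → Q) → (Q → P) → 𝟙 d ≡ 𝟙 d′
𝟙-cong (yes p) d′ f g = sym (𝟙-true d′ (f p))
𝟙-cong (no ¬p) d′ f g = sym (𝟙-false d′ (¬p ∘ g))

𝟙<𝟙 : (d : Dec P) (d′ : Dec Q) → 𝟙 d < 𝟙 d′ → ¬ P × Q
𝟙<𝟙 (no ¬p) (yes q) _ = ¬p , q
𝟙<𝟙 (yes _) (yes _) (s≤s ())

count : {P : Fin n → Set} → (∀ x → Dec (P x)) → ℕ
count P? = sum (λ x → 𝟙 (P? x))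

count-≡ : (x : Fin n) → count (_≟ x) ≡ 1
count-≡ x = trans (sum-concentrated x (λ y → 𝟙-false (y ≟ x))) (𝟙-true (x ≟ x) refl)

count-tight : {P Q : Fin n → Set} (P? : ∀ x → Dec (P x)) (Q? : ∀ x → Dec (Q x)) →
              (∀ {x} → P x → Q x) → count Q? ≤ count P? → ∀ {x} → Q x → P x
count-tight P? Q? P⊆Q ∑≤ {x} q = 𝟙-pos (≤-reflexive (trans (sym (𝟙-true (Q? x) q))
  (sym (sum-tight (λ y → 𝟙-≤ (P? y) (λ p → ≤-reflexive (sym (𝟙-true (Q? y) (P⊆Q p))))) ∑≤ x))))

-- Multigraphs on a decidable set of vertices

-- The vertex set is a predicate on a fixed `Fin n`, so contraction merely shrinks `A`, and one
-- subgraph `H` can be compared with every graph of the induction. `e x y` is a multiplicity.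
record Multigraph (n : ℕ) : Set₁ where
  field
    A     : Fin n → Set
    A?    : ∀ x → Dec (A x)
    e     : Fin n → Fin n → ℕ
    e-sym : ∀ x y → e x y ≡ e y x
    e-irr : ∀ x → e x x ≡ 0
    e-A   : ∀ {x y} → 1 ≤ e x y → A x

  deg : Fin n → ℕ
  deg x = sum (e x)

  order degreeSum : ℕ
  order     = count A?
  degreeSum = sum deg

  N[_] : Fin n → Fin n → Set
  N[ u ] y = y ≡ u ⊎ 1 ≤ e u y

  abstract
    -- Opaque, so that a case split on `y ≟ u` leaves `𝟙 (N[ u ]? y)` intact.
    N[_]? : ∀ u y → Dec (N[ u ] y)
    N[ u ]? y = y ≟ u ⊎-dec 1 ≤? e u y

  e-sym-pos : ∀ {x y} → 1 ≤ e x y → 1 ≤ e y x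
  e-sym-pos {x} {y} = subst (1 ≤_) (e-sym x y)

  e⇒≢ : ∀ {x y} → 1 ≤ e x y → x ≢ y
  e⇒≢ {x} pos refl = contradiction (subst (1 ≤_) (e-irr x) pos) λ ()

  N-sym : ∀ {x y} → N[ x ] y → N[ y ] x
  N-sym (inj₁ y≡x) = inj₁ (sym y≡x)
  N-sym (inj₂ xy)  = inj₂ (e-sym-pos xy)

  N⊆A : ∀ {x y} → A x → N[ x ] y → A y
  N⊆A ax (inj₁ refl) = ax
  N⊆A ax (inj₂ xy)   = e-A (e-sym-pos xy)

  N-≢ : ∀ {x y} → N[ x ] y → x ≢ y → 1 ≤ e x y
  N-≢ (inj₁ y≡x) x≢y = contradiction (sym y≡x) x≢y
  N-≢ (inj₂ xy)  _   = xy

  -- Since `v` and the points outside `A` are excluded here, the values of `col` on them are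
  -- arbitrary.
  Class : (Fin n → ℕ) → Fin n → Fin n → Fin n → Set
  Class col v x y = A y × y ≢ v × col y ≡ col x

  abstract
    class? : ∀ col v x y → Dec (Class col v x y)
    class? col v x y = A? y ×-dec ¬? (y ≟ v) ×-dec (col y ℕ.≟ col x)

  -- A partition of the vertices other than v into cliques with c vertices,
  -- given by its colour classes.
  record Factor (c : ℕ) (v : Fin n) : Set where
    field
      col          : Fin n → ℕ
      class-size   : ∀ {x} → A x → x ≢ v → count (class? col v x) ≡ c
      class-clique : ∀ {x y} → A x → x ≢ v → x ≢ y → Class col v x y → 1 ≤ e x y

  FaultTolerant : ℕ → Set
  FaultTolerant c = ∀ v → A v → Factor c v

  -- r is the only vertex of the clique N[u] that can have neighbours outside it.
  record Leaf (c : ℕ) (u r : Fin n) : Set where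
    field
      active : A u
      deg-u  : deg u ≡ c
      edge   : 1 ≤ e u r
      deg-N  : ∀ y → 1 ≤ e u y → y ≢ r → deg y ≡ c

open Multigraph using (Factor; FaultTolerant; Leaf; order; degreeSum)
open Factor
open Leaf

-- Vertices of degree `c` and their closed neighbourhoods.

module Cliques {n c : ℕ} (3≤c : 3 ≤ c) (G : Multigraph n) (ft : FaultTolerant G c) (2≤order : 2 ≤ order G) where
  open Multigraph G hiding (Factor; FaultTolerant; Leaf; order; degreeSum)

  other : ∀ x → ∃[ v ] (A v × v ≢ x)
  other x with sum<sum⇒∃< {f = λ y → 𝟙 (y ≟ x)} (≤-trans (s≤s (≤-reflexive (count-≡ x))) 2≤order)
  ... | v , lt with 𝟙<𝟙 (v ≟ x) (A? v) lt
  ... | v≢x , av = v , av , v≢x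

  -- Delete any other vertex: the class of `x` then has `c ≥ 3` members, all but `x` adjacent to
  -- `x`.
  neighbour : ∀ {x} → A x → ∃[ y ] 1 ≤ e x y
  neighbour {x} ax with other x
  ... | v , av , v≢x with ft v av
  ... | F with sum<sum⇒∃< {f = λ y → 𝟙 (y ≟ x)} {g = λ y → 𝟙 (class? (col F) v x y)}
                 (≤-trans (s≤s (≤-reflexive (count-≡ x)))
                   (≤-trans (≤-trans (s≤s (s≤s z≤n)) 3≤c) (≤-reflexive (sym (class-size F ax (v≢x ∘ sym))))))
  ... | y , lt with 𝟙<𝟙 (y ≟ x) (class? (col F) v x y) lt
  ... | y≢x , cl = y , class-clique F ax (v≢x ∘ sym) (y≢x ∘ sym) cl

  module _ {x v} (ax : A x) (xv : 1 ≤ e x v) where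
    private
      F   = ft v (e-A (e-sym-pos xv))
      cl? = class? (col F) v x

    -- When the neighbour `v` is deleted, the class of `x` still supplies `c - 1` neighbours, and
    -- `v` is one more. Summing over `y` gives `c ≤ deg x`. If `deg x ≡ c`, every term is an
    -- equality: all edges at `x` are simple, and each neighbour except `v` lies in the class of
    -- `x`.
    class-bound : ∀ y → 𝟙 (cl? y) + 𝟙 (y ≟ v) ≤ e x y + 𝟙 (y ≟ x)
    class-bound y with y ≟ v
    ... | yes refl rewrite 𝟙-false (cl? y) (λ cl → proj₁ (proj₂ cl) refl) = ≤-trans xv (m≤m+n _ _)
    ... | no y≢v rewrite +-identityʳ (𝟙 (cl? y)) with y ≟ x
    ...   | yes refl = ≤-trans (𝟙≤1 (cl? y)) (m≤n+m 1 _)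
    ...   | no y≢x   = 𝟙-≤ (cl? y) (λ cl → ≤-trans (class-clique F ax (e⇒≢ xv) (y≢x ∘ sym) cl) (m≤m+n _ _))

    sum-class : sum (λ y → 𝟙 (cl? y) + 𝟙 (y ≟ v)) ≡ c + 1
    sum-class = trans (∑-distrib-+ {n} _ _) (cong₂ _+_ (class-size F ax (e⇒≢ xv)) (count-≡ v))

    class-exact : deg x ≡ c → ∀ y → 𝟙 (cl? y) + 𝟙 (y ≟ v) ≡ e x y + 𝟙 (y ≟ x)
    class-exact dx = sum-tight class-bound (≤-reflexive
      (trans (∑-distrib-+ {n} _ _) (trans (cong₂ _+_ dx (count-≡ x)) (sym sum-class))))

    c≤deg′ : c ≤ deg x
    c≤deg′ = +-cancelʳ-≤ 1 _ _ (subst (_≤ deg x + 1) sum-class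
      (≤-trans (sum-mono class-bound) (≤-reflexive (trans (∑-distrib-+ {n} _ _) (cong (deg x +_) (count-≡ x))))))

    simple′ : deg x ≡ c → e x v ≡ 1
    simple′ dx = sym (trans (sym (cong₂ _+_ (𝟙-false (cl? v) (λ cl → proj₁ (proj₂ cl) refl)) (𝟙-true (v ≟ v) refl)))
      (trans (class-exact dx v) (trans (cong (e x v +_) (𝟙-false (v ≟ x) (e⇒≢ xv ∘ sym))) (+-identityʳ _))))

    in-class : deg x ≡ c → ∀ {y} → 1 ≤ e x y → y ≢ v → Class (col F) v x y
    in-class dx {y} xy y≢v = 𝟙-pos (≤-trans xy (≤-trans (m≤m+n _ _)
      (≤-reflexive (trans (sym (class-exact dx y)) (trans (cong (𝟙 (cl? y) +_) (𝟙-false (y ≟ v) y≢v)) (+-identityʳ _))))))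

  c≤deg : ∀ {x} → A x → c ≤ deg x
  c≤deg ax = c≤deg′ ax (proj₂ (neighbour ax))

  module _ {u} (au : A u) (du : deg u ≡ c) where

    simple : ∀ y → e u y ≤ 1
    simple y with 1 ≤? e u y
    ... | yes uy = ≤-reflexive (simple′ au uy du)
    ... | no ¬uy = <⇒≤ (≰⇒> ¬uy)

    -- Two neighbours y, z of u are adjacent because they are in the class of u
    -- when a third neighbour is deleted.
    neighbours-adjacent : ∀ {y z} → 1 ≤ e u y → 1 ≤ e u z → y ≢ z → 1 ≤ e y z
    neighbours-adjacent {y} {z} uy uz y≢z
      with sum<sum⇒∃< {f = λ k → 𝟙 (k ≟ y) + 𝟙 (k ≟ z)} {g = e u}
             (≤-trans (≤-reflexive (cong suc (trans (∑-distrib-+ {n} _ _) (cong₂ _+_ (count-≡ y) (count-≡ z)))))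
                      (≤-trans 3≤c (≤-reflexive (sym du))))
    ... | v , lt with v ≟ y | v ≟ z
    -- `y` and `z` account for 2 < 3 ≤ `deg u`, so some `v` has a surplus. If `v` were `y` or `z`,
    -- the surplus would be a multiple edge at `u`.
    ... | yes _  | _      = contradiction (≤-trans (s≤s (m≤m+n 1 _)) lt) (≤⇒≯ (simple v))
    ... | no _   | yes _  = contradiction lt (≤⇒≯ (simple v))
    ... | no v≢y | no v≢z with in-class au lt du uy (v≢y ∘ sym) | in-class au lt du uz (v≢z ∘ sym)
    ...   | ay , y≢v , cy | az , z≢v , cz =
      class-clique (ft v (e-A (e-sym-pos lt))) ay y≢v y≢z (az , z≢v , trans cz (sym cy))

    N-clique : ∀ {y z} → N[ u ] y → N[ u ] z → N[ y ] z
    N-clique (inj₁ refl) nz          = nz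
    N-clique (inj₂ uy)   (inj₁ refl) = inj₂ (e-sym-pos uy)
    N-clique {y} {z} (inj₂ uy) (inj₂ uz) with z ≟ y
    ... | yes z≡y = inj₁ z≡y
    ... | no z≢y  = inj₂ (neighbours-adjacent uy uz (z≢y ∘ sym))

    𝟙-N : ∀ y → 𝟙 (N[ u ]? y) ≡ e u y + 𝟙 (y ≟ u)
    𝟙-N y with y ≟ u
    ... | yes refl = trans (𝟙-true (N[ u ]? y) (inj₁ refl)) (sym (cong (_+ 1) (e-irr y)))
    ... | no y≢u with 1 ≤? e u y
    ...   | yes uy = trans (𝟙-true (N[ u ]? y) (inj₂ uy)) (sym (trans (+-identityʳ _) (simple′ au uy du)))
    ...   | no ¬uy = trans (𝟙-false (N[ u ]? y) λ { (inj₁ y≡u) → y≢u y≡u ; (inj₂ uy) → ¬uy uy })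
                       (sym (trans (+-identityʳ _) (n<1⇒n≡0 (≰⇒> ¬uy))))

    count-N : count N[ u ]? ≡ c + 1
    count-N = trans (sum-cong-≗ 𝟙-N) (trans (∑-distrib-+ {n} _ _) (cong₂ _+_ du (count-≡ u)))

  -- `N[ u ]` is a clique, hence contained in `N[ y ]`, and both have `c + 1` elements. So two
  -- adjacent vertices of degree `c` have the same closed neighbourhood.
  N-twin : ∀ {u y z} → A u → deg u ≡ c → deg y ≡ c → N[ u ] y → N[ y ] z → N[ u ] z
  N-twin {u} {y} au du dy uy = count-tight N[ u ]? N[ y ]? (N-clique au du uy)
    (≤-reflexive (trans (count-N (N⊆A au uy) dy) (sym (count-N au du))))

  module _ {u v} (au : A u) (du : deg u ≡ c) (av : A v) (u≢v : u ≢ v) where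
    private
      cl? = class? (col (ft v av)) v u

    class⊆N : ∀ {y} → Class (col (ft v av)) v u y → N[ u ] y
    class⊆N {y} cl with y ≟ u
    ... | yes y≡u = inj₁ y≡u
    ... | no y≢u  = inj₂ (class-clique (ft v av) au u≢v (y≢u ∘ sym) cl)

    -- The class of `u` lies in `N[ u ]` and has `c` of its `c + 1` vertices, so exactly one vertex
    -- `w` is left over. It is `v` itself if `v` is in `N[ u ]`, and otherwise belongs to another
    -- class.
    missing : ∃[ w ] (N[ u ] w × ∀ y → 𝟙 (cl? y) + 𝟙 (y ≟ w) ≡ 𝟙 (N[ u ]? y))
    missing with sum<sum⇒∃< {f = λ y → 𝟙 (cl? y)} {g = λ y → 𝟙 (N[ u ]? y)}
                   (≤-reflexive (trans (cong suc (class-size (ft v av) au u≢v)) (trans (+-comm 1 c) (sym (count-N au du)))))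
    ... | w , lt with 𝟙<𝟙 (cl? w) (N[ u ]? w) lt
    ... | ¬cl , nw = w , nw , sum-tight bound (≤-reflexive
            (trans (count-N au du) (sym (trans (∑-distrib-+ {n} _ _) (cong₂ _+_ (class-size (ft v av) au u≢v) (count-≡ w))))))
      where
      bound : ∀ y → 𝟙 (cl? y) + 𝟙 (y ≟ w) ≤ 𝟙 (N[ u ]? y)
      bound y with y ≟ w
      ... | yes refl = ≤-reflexive (trans (cong (_+ 1) (𝟙-false (cl? y) ¬cl)) (sym (𝟙-true (N[ u ]? y) nw)))
      ... | no _     = ≤-trans (≤-reflexive (+-identityʳ _))
                         (𝟙-≤ (cl? y) (λ cl → ≤-reflexive (sym (𝟙-true (N[ u ]? y) (class⊆N cl)))))

-- Exchanging two vertices.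

module Transposition {n : ℕ} (s w : Fin n) where

  π : Permutation n n
  π = transpose s w

  τ : Fin n → Fin n
  τ = π ⟨$⟩ʳ_

  τ-injective : ∀ {x y} → τ x ≡ τ y → x ≡ y
  τ-injective eq = trans (sym (inverseˡ π)) (trans (cong (π ⟨$⟩ˡ_) eq) (inverseˡ π))

  τ-s : τ s ≡ w
  τ-s rewrite dec-true (s ≟ s) refl = refl

  τ-w : τ w ≡ s
  τ-w with w ≟ s
  ... | yes w≡s = w≡s
  ... | no _ rewrite dec-true (w ≟ w) refl = refl

  τ-other : ∀ {x} → x ≢ s → x ≢ w → τ x ≡ x
  τ-other {x} x≢s x≢w rewrite dec-false (x ≟ s) x≢s | dec-false (x ≟ w) x≢w = refl

  module _ (P : Fin n → Set) (ps : P s) (pw : P w) where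

    τ-preserves : ∀ {x} → P x → P (τ x)
    τ-preserves {x} px = by (x ≟ s) (x ≟ w)
      where
      by : Dec (x ≡ s) → Dec (x ≡ w) → P (τ x)
      by (yes refl) _          = subst P (sym τ-s) pw
      by (no _)     (yes refl) = subst P (sym τ-w) ps
      by (no x≢s)   (no x≢w)   = subst P (sym (τ-other x≢s x≢w)) px

    τ-reflects : ∀ {x} → P (τ x) → P x
    τ-reflects {x} pτx = by (x ≟ s) (x ≟ w)
      where
      by : Dec (x ≡ s) → Dec (x ≡ w) → P x
      by (yes refl) _          = ps
      by (no _)     (yes refl) = pw
      by (no x≢s)   (no x≢w)   = subst P (τ-other x≢s x≢w) pτx

-- Contraction of the clique N[u] onto one of its vertices s, keeping edge
-- multiplicities and dropping loops.

module Contraction {n c : ℕ} (3≤c : 3 ≤ c) (G : Multigraph n) (ft : FaultTolerant G c) (2≤order : 2 ≤ order G)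
  {u : Fin n} (au : Multigraph.A G u) (du : Multigraph.deg G u ≡ c) {s : Fin n} (us : Multigraph.N[_] G u s) where
  open Multigraph G hiding (Factor; FaultTolerant; Leaf; order; degreeSum)
  open Cliques 3≤c G ft 2≤order

  h : Fin n → Fin n
  h x with N[ u ]? x
  ... | yes _ = s
  ... | no _  = x

  h-in : ∀ {x} → N[ u ] x → h x ≡ s
  h-in {x} ux with N[ u ]? x
  ... | yes _  = refl
  ... | no ¬ux = contradiction ux ¬ux

  h-out : ∀ {x} → ¬ N[ u ] x → h x ≡ x
  h-out {x} ¬ux with N[ u ]? x
  ... | yes ux = contradiction ux ¬ux
  ... | no _   = refl

  fixed⇒out : ∀ {x} → h x ≡ x → x ≢ s → ¬ N[ u ] x
  fixed⇒out hx≡x x≢s ux = x≢s (trans (sym hx≡x) (h-in ux))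

  out⇒u≢ : ∀ {x} → ¬ N[ u ] x → u ≢ x
  out⇒u≢ ¬ux refl = ¬ux (inj₁ refl)

  -- The fixed points of `h` are the vertices outside `N[ u ]` together with the representative `s`.
  A′ : Fin n → Set
  A′ x = A x × h x ≡ x

  A′? : ∀ x → Dec (A′ x)
  A′? x = A? x ×-dec (h x ≟ x)

  A⇒A′h : ∀ {x} → A x → A′ (h x)
  A⇒A′h {x} ax = by (N[ u ]? x)
    where
    by : Dec (N[ u ] x) → A′ (h x)
    by (yes ux) = subst A′ (sym (h-in ux)) (N⊆A au us , h-in us)
    by (no ¬ux) = subst A′ (sym (h-out ¬ux)) (ax , h-out ¬ux)

  -- The pushforward of the weight `f` along `h`.
  push : (Fin n → ℕ) → Fin n → ℕ
  push f y = sum (λ b → 𝟙 (h b ≟ y) * f b)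

  push-summand : ∀ (f : Fin n → ℕ) {b y} → h b ≡ y → 𝟙 (h b ≟ y) * f b ≡ f b
  push-summand f {b} {y} eq = trans (cong (_* f b) (𝟙-true (h b ≟ y) eq)) (+-identityʳ _)

  sum-push : ∀ (f : Fin n → ℕ) → sum (push f) ≡ sum f
  sum-push f = trans (∑-comm {n} {n} (λ y b → 𝟙 (h b ≟ y) * f b)) (sum-cong-≗ (λ b →
    trans (sum-concentrated (h b) (λ y y≢hb → cong (_* f b) (𝟙-false (h b ≟ y) (y≢hb ∘ sym)))) (push-summand f refl)))

  push-out : ∀ (f : Fin n → ℕ) {y} → ¬ N[ u ] y → push f y ≡ f y
  push-out f {y} ¬uy = trans (sum-concentrated y vanish) (push-summand f (h-out ¬uy))
    where
    hb≢y : ∀ {b} → b ≢ y → Dec (N[ u ] b) → h b ≢ y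
    hb≢y b≢y (yes ub) hb≡y = ¬uy (subst N[ u ] (trans (sym (h-in ub)) hb≡y) us)
    hb≢y b≢y (no ¬ub) hb≡y = b≢y (trans (sym (h-out ¬ub)) hb≡y)
    vanish : ∀ b → b ≢ y → 𝟙 (h b ≟ y) * f b ≡ 0
    vanish b b≢y = cong (_* f b) (𝟙-false (h b ≟ y) (hb≢y b≢y (N[ u ]? b)))

  push-≥ : ∀ (f : Fin n → ℕ) {b y} → h b ≡ y → f b ≤ push f y
  push-≥ f {b} {y} eq = ≤-trans (≤-reflexive (sym (push-summand f eq))) (term≤sum (λ k → 𝟙 (h k ≟ y) * f k) b)

  push-≥₂ : ∀ (f : Fin n → ℕ) {a b y} → a ≢ b → h a ≡ y → h b ≡ y → f a + f b ≤ push f y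
  push-≥₂ f {a} {b} {y} a≢b ha hb =
    ≤-trans (≤-reflexive (sym (cong₂ _+_ (push-summand f ha) (push-summand f hb))))
            (terms≤sum (λ k → 𝟙 (h k ≟ y) * f k) a≢b)

  push-positive : ∀ (f : Fin n → ℕ) {y} → 1 ≤ push f y → ∃[ b ] (h b ≡ y × 1 ≤ f b)
  push-positive f {y} pos with sum-positive pos
  ... | b , pos-b with h b ≟ y
  ... | yes eq = b , eq , ≤-trans pos-b (≤-reflexive (+-identityʳ _))
  ... | no _   = contradiction pos-b λ ()

  -- The quotient with its loops still present. `m s s` counts ordered adjacent pairs inside
  -- `N[ u ]` with multiplicity, which is exactly what dropping loops loses.
  m : Fin n → Fin n → ℕ
  m x y = push (λ a → push (e a) y) x

  m-sym : ∀ x y → m x y ≡ m y x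
  m-sym x y = trans (expand x y) (trans (∑-comm {n} {n} _) (trans (sum-cong-≗ (λ b → sum-cong-≗ (swap b))) (sym (expand y x))))
    where
    expand : ∀ x y → m x y ≡ sum (λ a → sum (λ b → 𝟙 (h a ≟ x) * (𝟙 (h b ≟ y) * e a b)))
    expand x y = sum-cong-≗ (λ a → *-distribˡ-sum {n} (𝟙 (h a ≟ x)) _)
    swap : ∀ b a → 𝟙 (h a ≟ x) * (𝟙 (h b ≟ y) * e a b) ≡ 𝟙 (h b ≟ y) * (𝟙 (h a ≟ x) * e b a)
    swap b a rewrite e-sym a b = trans (sym (*-assoc i j k)) (trans (cong (_* k) (*-comm i j)) (*-assoc j i k))
      where
      i = 𝟙 (h a ≟ x)
      j = 𝟙 (h b ≟ y)
      k = e b a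

  sum-m : ∀ x → sum (m x) ≡ push deg x
  sum-m x = trans (∑-comm {n} {n} _) (sum-cong-≗ (λ a →
    trans (sym (*-distribˡ-sum {n} (𝟙 (h a ≟ x)) (push (e a)))) (cong (𝟙 (h a ≟ x) *_) (sum-push (e a)))))

  e′ : Fin n → Fin n → ℕ
  e′ x y = 𝟙 (¬? (x ≟ y)) * m x y

  e′≤m : ∀ x y → e′ x y ≤ m x y
  e′≤m x y = ≤-trans (*-monoˡ-≤ (m x y) (𝟙≤1 (¬? (x ≟ y)))) (≤-reflexive (+-identityʳ _))

  e′≡m : ∀ {x y} → x ≢ y → e′ x y ≡ m x y
  e′≡m {x} {y} x≢y = trans (cong (_* m x y) (𝟙-true (¬? (x ≟ y)) x≢y)) (+-identityʳ _)

  e′-irr : ∀ x → e′ x x ≡ 0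
  e′-irr x = cong (_* m x x) (𝟙-false (¬? (x ≟ x)) (λ x≢x → x≢x refl))

  e′-sym : ∀ x y → e′ x y ≡ e′ y x
  e′-sym x y = cong₂ _*_ (𝟙-cong (¬? (x ≟ y)) (¬? (y ≟ x)) (_∘ sym) (_∘ sym)) (m-sym x y)

  e′-A : ∀ {x y} → 1 ≤ e′ x y → A′ x
  e′-A {x} {y} pos with push-positive _ (≤-trans pos (e′≤m x y))
  ... | a , refl , pos-a with push-positive _ pos-a
  ... | b , _ , ab = A⇒A′h (e-A ab)

  e⇒e′ : ∀ {a b} → h a ≢ h b → e a b ≤ e′ (h a) (h b)
  e⇒e′ {a} {b} ha≢hb = ≤-trans (≤-trans (push-≥ (e a) refl) (push-≥ (λ k → push (e k) (h b)) refl))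
    (≤-reflexive (sym (e′≡m ha≢hb)))

  G/N : Multigraph n
  G/N = record { A = A′ ; A? = A′? ; e = e′ ; e-sym = e′-sym ; e-irr = e′-irr ; e-A = e′-A }

  deg′ : Fin n → ℕ
  deg′ = Multigraph.deg G/N

  e′-out : ∀ {x} → ¬ N[ u ] x → ∀ y → e′ x y ≡ push (e x) y
  e′-out {x} ¬ux y with x ≟ y
  ... | yes refl = sym (trans (push-out (e x) ¬ux) (e-irr x))
  ... | no x≢y   = trans (+-identityʳ _) (push-out (λ a → push (e a) y) ¬ux)

  e′-out₂ : ∀ {x y} → ¬ N[ u ] x → ¬ N[ u ] y → e′ x y ≡ e x y
  e′-out₂ {x} {y} ¬ux ¬uy = trans (e′-out ¬ux y) (push-out (e x) ¬uy)

  -- This is where multiplicities pay off: all edges from `x` into `N[ u ]` survive as parallel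
  -- edges to `s`.
  deg′-out : ∀ {x} → ¬ N[ u ] x → deg′ x ≡ deg x
  deg′-out {x} ¬ux = trans (sum-cong-≗ (e′-out ¬ux)) (sum-push (e x))

  order-/N : order G/N + c ≡ order G
  order-/N = +-cancelʳ-≡ 1 _ _ (trans (+-assoc _ c 1) (trans (cong (order G/N +_) (sym (count-N au du)))
    (trans (sym (∑-distrib-+ {n} _ _)) (trans (sum-cong-≗ pointwise)
      (trans (∑-distrib-+ {n} _ _) (cong (order G +_) (count-≡ s)))))))
    where
    pointwise : ∀ y → 𝟙 (A′? y) + 𝟙 (N[ u ]? y) ≡ 𝟙 (A? y) + 𝟙 (y ≟ s)
    pointwise y = by (N[ u ]? y) (y ≟ s)
      where
      by : (d : Dec (N[ u ] y)) (d′ : Dec (y ≡ s)) → 𝟙 (A′? y) + 𝟙 d ≡ 𝟙 (A? y) + 𝟙 d′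
      by (yes uy) (yes refl) = cong (_+ 1) (trans (𝟙-true (A′? y) (N⊆A au uy , h-in uy)) (sym (𝟙-true (A? y) (N⊆A au uy))))
      by (yes uy) (no y≢s)   = trans (cong (_+ 1) (𝟙-false (A′? y) (λ a′ → fixed⇒out (proj₂ a′) y≢s uy)))
                                 (sym (trans (+-identityʳ _) (𝟙-true (A? y) (N⊆A au uy))))
      by (no ¬uy) (yes refl) = contradiction us ¬uy
      by (no ¬uy) (no y≢s)   = cong (_+ 0) (𝟙-cong (A′? y) (A? y) proj₁ (λ ay → ay , h-out ¬uy))

  -- Each of the `c + 1` members of the clique `N[ u ]` is adjacent to the other `c`.
  m-ss : (c + 1) * c ≤ m s s
  m-ss = ≤-trans (≤-reflexive (trans (cong (_* c) (sym (count-N au du))) (*-distribʳ-sum {n} c _))) (sum-mono row)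
    where
    entry : ∀ {a} → N[ u ] a → ∀ b → 𝟙 (N[ u ]? b) ≤ 𝟙 (h b ≟ s) * e a b + 𝟙 (b ≟ a)
    entry {a} ua b = 𝟙-≤ (N[ u ]? b) (λ ub → by ub (b ≟ a))
      where
      by : N[ u ] b → (d : Dec (b ≡ a)) → 1 ≤ 𝟙 (h b ≟ s) * e a b + 𝟙 d
      by ub (yes _)  = m≤n+m 1 _
      by ub (no b≢a) = ≤-trans (N-≢ (N-clique au du ua ub) (b≢a ∘ sym))
        (≤-trans (≤-reflexive (sym (push-summand (e a) (h-in ub)))) (m≤m+n _ _))
    row-in : ∀ {a} → N[ u ] a → c ≤ push (e a) s
    row-in {a} ua = +-cancelʳ-≤ 1 _ _ (≤-trans (≤-reflexive (sym (count-N au du))) (≤-trans (sum-mono (entry ua))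
      (≤-reflexive (trans (∑-distrib-+ {n} _ _) (cong (push (e a) s +_) (count-≡ a))))))
    row : ∀ a → 𝟙 (N[ u ]? a) * c ≤ 𝟙 (h a ≟ s) * push (e a) s
    row a = by (N[ u ]? a)
      where
      by : (d : Dec (N[ u ] a)) → 𝟙 d * c ≤ 𝟙 (h a ≟ s) * push (e a) s
      by (no _)   = z≤n
      by (yes ua) = ≤-trans (≤-reflexive (+-identityʳ c))
        (≤-trans (row-in ua) (≤-reflexive (sym (push-summand (λ k → push (e k) s) (h-in ua)))))

  -- Pushing forward preserves the total of all degrees, so `m` still sums to `degreeSum G`;
  -- removing the loop entry `m s s` then costs at least `(c + 1) * c`.
  degreeSum-/N : degreeSum G/N + (c + 1) * c ≤ degreeSum G
  degreeSum-/N = ≤-trans (≤-reflexive (sym split)) (≤-trans (sum-mono row) (≤-reflexive (trans (sum-cong-≗ sum-m) (sum-push deg))))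
    where
    K = (c + 1) * c
    sum-at-s : sum (λ x → 𝟙 (x ≟ s) * K) ≡ K
    sum-at-s = trans (sym (*-distribʳ-sum {n} K _)) (trans (cong (_* K) (count-≡ s)) (+-identityʳ K))
    split : sum (λ x → deg′ x + 𝟙 (x ≟ s) * K) ≡ degreeSum G/N + K
    split = trans (∑-distrib-+ {n} _ _) (cong (degreeSum G/N +_) sum-at-s)
    entry : ∀ y → e′ s y + 𝟙 (y ≟ s) * K ≤ m s y
    entry y with y ≟ s
    ... | no _     = ≤-trans (≤-reflexive (+-identityʳ _)) (e′≤m s y)
    ... | yes refl = ≤-trans (≤-reflexive (trans (cong (_+ (K + 0)) (e′-irr s)) (+-identityʳ K))) m-ss
    row : ∀ x → deg′ x + 𝟙 (x ≟ s) * K ≤ sum (m x)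
    row x with x ≟ s
    ... | no _     = ≤-trans (≤-reflexive (+-identityʳ _)) (sum-mono (e′≤m x))
    ... | yes refl = ≤-trans (≤-reflexive (trans (cong (deg′ s +_) (trans (+-identityʳ K) (sym sum-at-s))) (sym (∑-distrib-+ {n} _ _)))) (sum-mono entry)

  -- A factor of G - v₀ in which the class of u is N[u] minus w becomes one of G/N
  -- by letting s play the role of w.
  module _ {v v₀ w : Fin n} (av₀ : A v₀) (u≢v₀ : u ≢ v₀) (uw : N[ u ] w)
    (rest : ∀ y → 𝟙 (class? (col (ft v₀ av₀)) v₀ u y) + 𝟙 (y ≟ w) ≡ 𝟙 (N[ u ]? y))
    (τv : Transposition.τ s w v ≡ v₀) where
    open Transposition s w
    private
      F = ft v₀ av₀

      aw : A w
      aw = N⊆A au uw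

      as : A s
      as = N⊆A au us

      class-u⇒N : ∀ {y} → Class (col F) v₀ u y → N[ u ] y × y ≢ w
      class-u⇒N {y} cl = class⊆N au du av₀ u≢v₀ cl , λ { refl → contradiction
        (trans (sym (cong₂ _+_ (𝟙-true (class? (col F) v₀ u y) cl) (𝟙-true (y ≟ y) refl))) (rest y))
        (λ eq → contradiction (≤-trans (≤-reflexive eq) (𝟙≤1 (N[ u ]? y))) λ { (s≤s ()) }) }

      N⇒class-u : ∀ {y} → N[ u ] y → y ≢ w → Class (col F) v₀ u y
      N⇒class-u {y} uy y≢w = 𝟙-pos (≤-reflexive (trans (sym (𝟙-true (N[ u ]? y) uy)) (trans (sym (rest y))
        (trans (cong (𝟙 (class? (col F) v₀ u y) +_) (𝟙-false (y ≟ w) y≢w)) (+-identityʳ _)))))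

      ≢v⇒τ≢v₀ : ∀ {x} → x ≢ v → τ x ≢ v₀
      ≢v⇒τ≢v₀ x≢v τx≡v₀ = x≢v (τ-injective (trans τx≡v₀ (sym τv)))

      hτ : ∀ {x} → h x ≡ x → h (τ x) ≡ x
      hτ {x} hx≡x = by (x ≟ s)
        where
        by : Dec (x ≡ s) → h (τ x) ≡ x
        by (yes refl) = trans (cong h τ-s) (h-in uw)
        by (no x≢s)   = trans (cong h (τ-other x≢s (λ { refl → fixed⇒out hx≡x x≢s uw }))) hx≡x

      -- If `y` were a contracted vertex other than `s`, then `τ y` would lie in `N[ u ]` minus `w`,
      -- the class of `u`. So would `τ x`, and `x` would be contracted as well.
      class⇒fixed : ∀ {x y} → A′ x → x ≢ v → Class (col F) v₀ (τ x) (τ y) → h y ≡ y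
      class⇒fixed {x} {y} (ax , hx≡x) x≢v (aτy , τy≢v₀ , same) = by (N[ u ]? y) (y ≟ s)
        where
        by : Dec (N[ u ] y) → Dec (y ≡ s) → h y ≡ y
        by (no ¬uy) _          = h-out ¬uy
        by (yes uy) (yes refl) = h-in uy
        by (yes uy) (no y≢s)
          with N⇒class-u (τ-preserves N[ u ] us uw uy) (λ τy≡w → y≢s (τ-injective (trans τy≡w (sym τ-s))))
        ... | _ , _ , cy with class-u⇒N (τ-preserves A as aw ax , ≢v⇒τ≢v₀ x≢v , trans (sym same) cy)
        ... | uτx , τx≢w = contradiction (τ-reflects N[ u ] us uw uτx)
                             (fixed⇒out hx≡x (λ { refl → τx≢w τ-s }))

      class⇔ : ∀ {x} → A′ x → x ≢ v → ∀ y →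
               𝟙 (Multigraph.class? G/N (col F ∘ τ) v x y) ≡ 𝟙 (class? (col F) v₀ (τ x) (τ y))
      class⇔ {x} a′x x≢v y = 𝟙-cong (Multigraph.class? G/N (col F ∘ τ) v x y) (class? (col F) v₀ (τ x) (τ y))
        (λ { ((ay , _) , y≢v , same) → τ-preserves A as aw ay , ≢v⇒τ≢v₀ y≢v , same })
        (λ { cl@(aτy , τy≢v₀ , same) → (τ-reflects A as aw aτy , class⇒fixed a′x x≢v cl) , (λ { refl → τy≢v₀ τv }) , same })

    contracted-factor : Factor G/N c v
    contracted-factor = record
      { col          = col F ∘ τ
      ; class-size   = λ {x} a′x x≢v → trans (sum-cong-≗ (class⇔ a′x x≢v))
          (trans (sym (sum-permute (λ y → 𝟙 (class? (col F) v₀ (τ x) y)) π))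
                 (class-size F (τ-preserves A as aw (proj₁ a′x)) (≢v⇒τ≢v₀ x≢v)))
      -- `h` sends `τ x` and `τ y` back to the distinct vertices `x` and `y`, so the edge between
      -- them does not become a loop.
      ; class-clique = λ { {x} {y} (ax , hx≡x) x≢v x≢y ((ay , hy≡y) , y≢v , same) →
          subst (1 ≤_) (cong₂ e′ (hτ hx≡x) (hτ hy≡y)) (≤-trans
            (class-clique F (τ-preserves A as aw ax) (≢v⇒τ≢v₀ x≢v) (x≢y ∘ τ-injective)
              (τ-preserves A as aw ay , ≢v⇒τ≢v₀ y≢v , same))
            (e⇒e′ (λ eq → x≢y (trans (sym (hτ hx≡x)) (trans eq (hτ hy≡y)))))) }
      }

  -- To delete `s`, delete a neighbour `v₀` of `u` in `G`: the class of `u` is then the rest of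
  -- `N[ u ]`, and the other classes avoid `N[ u ]`. To delete another `v`, delete it in `G` as
  -- well: the left-over vertex `w` lies in some other class, where `s` replaces it.
  ft-/N : FaultTolerant G/N c
  ft-/N v (av , hv≡v) with v ≟ s
  ... | yes refl with neighbour au
  ...   | v₀ , uv₀ with missing au du (e-A (e-sym-pos uv₀)) (e⇒≢ uv₀)
  ...     | w , uw , rest = contracted-factor (e-A (e-sym-pos uv₀)) (e⇒≢ uv₀) uw rest
              (trans (Transposition.τ-s s w) w≡v₀)
    where
    -- `v₀` is in `N[ u ]` but, being deleted, in no class.
    w≡v₀ : w ≡ v₀
    w≡v₀ = sym (𝟙-pos (≤-reflexive (sym (trans (cong (_+ 𝟙 (v₀ ≟ w)) (sym (𝟙-false (class? _ v₀ u v₀) (λ cl → proj₁ (proj₂ cl) refl))))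
      (trans (rest v₀) (𝟙-true (N[ u ]? v₀) (inj₂ uv₀)))))))
  ft-/N v (av , hv≡v) | no v≢s with missing au du av (out⇒u≢ (fixed⇒out hv≡v v≢s))
  ... | w , uw , rest = contracted-factor av (out⇒u≢ (fixed⇒out hv≡v v≢s)) uw rest
          (Transposition.τ-other s w v≢s (λ { refl → fixed⇒out hv≡v v≢s uw }))

  -- Degrees outside `N[ u ]` agree in both graphs, so only `s` can spoil the leaf. If `s` is not in
  -- the clique, the leaf is unchanged. If `s` is its attachment vertex, the unique neighbour of `x`
  -- in `N[ u ]` takes over that role.
  lift-leaf : 2 ≤ order G/N → ∀ {x r} → Leaf G/N c x r → s ≡ r ⊎ ¬ Multigraph.N[_] G/N x s →
              ¬ N[ u ] x × ∃[ r′ ] Leaf G c x r′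
  lift-leaf 2≤order′ {x} {r} L far = ¬ux , lifted far
    where
    module G′ = Multigraph G/N

    far⇒≢ : s ≡ r ⊎ ¬ G′.N[ x ] s → x ≢ s
    far⇒≢ (inj₁ refl) = G′.e⇒≢ (edge L)
    far⇒≢ (inj₂ ¬xs)  = λ { refl → ¬xs (inj₁ refl) }

    ¬ux : ¬ N[ u ] x
    ¬ux = fixed⇒out (proj₂ (active L)) (far⇒≢ far)

    degree : ∀ {y} → ¬ N[ u ] y → 1 ≤ e x y → y ≢ r → deg y ≡ c
    degree ¬uy xy y≢r = trans (sym (deg′-out ¬uy)) (deg-N L _ (subst (1 ≤_) (sym (e′-out₂ ¬ux ¬uy)) xy) y≢r)

    lifted : s ≡ r ⊎ ¬ G′.N[ x ] s → ∃[ r′ ] Leaf G c x r′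
    lifted (inj₂ ¬xs) = r , record
      { active = proj₁ (active L)
      ; deg-u  = trans (sym (deg′-out ¬ux)) (deg-u L)
      ; edge   = subst (1 ≤_) (e′-out₂ ¬ux ¬ur) (edge L)
      ; deg-N  = λ y xy → degree (λ uy → ¬xs (inj₂ (≤-trans xy (≤-trans (push-≥ (e x) (h-in uy))
                   (≤-reflexive (sym (e′-out ¬ux s))))))) xy
      }
      where
      ¬ur : ¬ N[ u ] r
      ¬ur = fixed⇒out (proj₂ (G′.e-A {r} {x} (G′.e-sym-pos {x} (edge L)))) (λ { refl → ¬xs (inj₂ (edge L)) })
    lifted (inj₁ refl) with push-positive (e x) (subst (1 ≤_) (e′-out ¬ux s) (edge L))
    ... | w , hw≡s , xw = w , record
      { active = proj₁ (active L)
      ; deg-u  = trans (sym (deg′-out ¬ux)) (deg-u L)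
      ; edge   = xw
      ; deg-N  = λ y xy y≢w → degree (unique xy y≢w) xy (λ { refl → unique xy y≢w us })
      }
      where
      -- Two neighbours of `x` in `N[ u ]` would yield a double edge from `x` to `s`, but `x` has
      -- degree `c` in `G/N` and hence only simple edges.
      unique : ∀ {y} → 1 ≤ e x y → y ≢ w → ¬ N[ u ] y
      unique xy y≢w uy = contradiction
        (≤-trans (+-mono-≤ xy xw) (≤-trans (push-≥₂ (e x) y≢w (h-in uy) hw≡s) (≤-trans (≤-reflexive (sym (e′-out ¬ux s)))
          (Cliques.simple 3≤c G/N ft-/N 2≤order′ (active L) (deg-u L) s))))
        λ { (s≤s ()) }

  -- Contracting a leaf onto its attachment vertex merely deletes the rest of it.
  e′⇒e : (∀ y → N[ u ] y → y ≢ s → deg y ≡ c) → ∀ {x y} → 1 ≤ e′ x y → 1 ≤ e x y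
  e′⇒e inner {x} {y} x′y with push-positive _ (≤-trans x′y (e′≤m x y))
  ... | a , refl , pos with push-positive _ pos
  ... | b , refl , ab = subst (1 ≤_) (sym (cong₂ e (fixes ab ha≢hb) (fixes (e-sym-pos ab) (ha≢hb ∘ sym)))) ab
    where
    ha≢hb : h a ≢ h b
    ha≢hb = Multigraph.e⇒≢ G/N x′y
    fixes : ∀ {a b} → 1 ≤ e a b → h a ≢ h b → h a ≡ a
    fixes {a} {b} ab ha≢hb = by (N[ u ]? a) (a ≟ s)
      where
      by : Dec (N[ u ] a) → Dec (a ≡ s) → h a ≡ a
      by (no ¬ua) _          = h-out ¬ua
      by (yes ua) (yes refl) = h-in ua
      -- All neighbours of an inner vertex `a` lie in `N[ u ]`, so the edge `a b` would have become
      -- a loop.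
      by (yes ua) (no a≢s)   = contradiction
        (trans (h-in ua) (sym (h-in (N-twin au du (inner a ua a≢s) ua (inj₂ ab))))) ha≢hb

-- Leaves

-- Here `suc k` is `p`. The degree bound is twice the edge bound, which avoids halving.
record Tight (c k : ℕ) {n : ℕ} (G : Multigraph n) : Set where
  field
    ft           : FaultTolerant G c
    order-≡      : order G ≡ suc k * c + 1
    degreeSum-≤  : degreeSum G ≤ suc k * ((c + 1) * c)

module Leaves {c : ℕ} (3≤c : 3 ≤ c) {n : ℕ} where

  module Tightness {k : ℕ} (G : Multigraph n) (tight : Tight c k G) where
    open Multigraph G hiding (Factor; FaultTolerant; Leaf; order; degreeSum)
    open Tight tight public

    2≤order : 2 ≤ order G
    2≤order = ≤-trans (≤-trans (≤-trans (s≤s (s≤s z≤n)) 3≤c) (≤-trans (m≤m+n c (k * c)) (m≤m+n _ 1)))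
                      (≤-reflexive (sym order-≡))

    open Cliques 3≤c G ft 2≤order public

    -- With `p = suc k`, degrees of at least `c + 1` throughout would total `(p * c + 1) * (c + 1)`,
    -- which exceeds `p * ((c + 1) * c)` by `c + 1`. So some degree is at most `c`, and `c≤deg`
    -- gives equality.
    minimum-degree : ∃[ u ] (A u × deg u ≡ c)
    minimum-degree with sum<sum⇒∃< {f = deg} {g = λ x → 𝟙 (A? x) * (c + 1)}
      (≤-trans (s≤s degreeSum-≤) (≤-trans (≤-trans (m≤m+n _ c) (≤-reflexive (arith (suc k) c)))
        (≤-reflexive (trans (cong (_* (c + 1)) (sym order-≡)) (*-distribʳ-sum {n} (c + 1) _)))))
      where
      arith : ∀ p c → suc (p * ((c + 1) * c)) + c ≡ (p * c + 1) * (c + 1)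
      arith = solve-∀
    ... | u , lt with A? u
    ... | no _   = contradiction lt λ ()
    ... | yes au = u , au , ≤-antisym (≤-pred (≤-trans lt (≤-reflexive (trans (+-identityʳ _) (+-comm c 1))))) (c≤deg au)

  module _ (G : Multigraph n) (tight : Tight c 0 G) where
    open Multigraph G hiding (Factor; FaultTolerant; Leaf; order; degreeSum)
    open Tightness G tight

    order-≡c+1 : order G ≡ c + 1
    order-≡c+1 = trans order-≡ (cong (_+ 1) (+-identityʳ c))

    A⊆N : ∀ {u y} → A u → deg u ≡ c → A y → N[ u ] y
    A⊆N {u} au du = count-tight N[ u ]? A? (N⊆A au) (≤-reflexive (trans order-≡c+1 (sym (count-N au du))))

    -- There are `c + 1` vertices of degree at least `c`, and the total is at most `(c + 1) * c`. So
    -- for `k = 0` the graph is a single clique.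
    regular : ∀ {x} → A x → deg x ≡ c
    regular {x} ax = trans (sym (sum-tight bound (≤-trans degreeSum-≤ (≤-reflexive (trans (+-identityʳ _)
      (trans (cong (_* c) (sym order-≡c+1)) (*-distribʳ-sum {n} c _))))) x))
      (trans (cong (_* c) (𝟙-true (A? x) ax)) (+-identityʳ c))
      where
      bound : ∀ x → 𝟙 (A? x) * c ≤ deg x
      bound x with A? x
      ... | no _   = z≤n
      ... | yes ax = ≤-trans (≤-reflexive (+-identityʳ c)) (c≤deg ax)

  -- `z` may be the attachment vertex but no other vertex of the leaf. With `z` the contracted
  -- vertex, this is the condition under which `lift-leaf` applies.
  LeafAvoiding : Multigraph n → Set
  LeafAvoiding G = ∀ z → Multigraph.A G z → ∃[ u ] ∃[ r ] (Leaf G c u r × (z ≡ r ⊎ ¬ Multigraph.N[_] G u z))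

  module Step {k : ℕ} (G : Multigraph n) (tight : Tight c (suc k) G) where
    open Multigraph G hiding (Factor; FaultTolerant; Leaf; order; degreeSum)
    open Tightness G tight

    module _ {u s} (au : A u) (du : deg u ≡ c) (us : N[ u ] s) where
      open Contraction 3≤c G ft 2≤order au du us

      tight-/N : Tight c k G/N
      tight-/N = record
        { ft          = ft-/N
        ; order-≡     = +-cancelʳ-≡ c _ _ (trans order-/N (trans order-≡ (arith₁ c (suc k * c))))
        ; degreeSum-≤ = +-cancelʳ-≤ ((c + 1) * c) _ _ (≤-trans degreeSum-/N (≤-trans degreeSum-≤ (≤-reflexive (+-comm ((c + 1) * c) _))))
        }
        where
        arith₁ : ∀ a b → a + b + 1 ≡ b + 1 + a
        arith₁ = solve-∀

    module _ (IH : ∀ G′ → Tight c k G′ → LeafAvoiding G′) where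

      -- Contract `N[ u ]` onto `u` itself, take a leaf avoiding the contracted vertex, and lift it.
      leaf-outside : ∀ {u} → A u → deg u ≡ c → ∃[ x ] (¬ N[ u ] x × ∃[ r ] Leaf G c x r)
      leaf-outside {u} au du with IH _ (tight-/N au du (inj₁ refl)) u (au , Contraction.h-in 3≤c G ft 2≤order au du (inj₁ refl) (inj₁ refl))
      ... | x , r , L , far = x , Contraction.lift-leaf 3≤c G ft 2≤order au du (inj₁ refl)
              (Tightness.2≤order _ (tight-/N au du (inj₁ refl))) L far

      leaf-avoiding-step : LeafAvoiding G
      leaf-avoiding-step z az with minimum-degree
      ... | u , au , du with leaf-outside au du
      ... | x , _ , r , L with z ≟ r | N[ x ]? z
      ... | yes z≡r | _      = x , r , L , inj₁ z≡r
      ... | no _    | no ¬xz = x , r , L , inj₂ ¬xz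
      -- The leaf at `x` has `z` as an inner vertex, so a second leaf is sought outside `N[ x ]`.
      -- Its `y` is not adjacent to `z`, because `z` has degree `c` and so `N[ z ]` is contained in
      -- `N[ x ]`.
      ... | no z≢r  | yes xz with leaf-outside (active L) (deg-u L)
      ... | y , ¬xy , r′ , L′ = y , r′ , L′ , inj₂ (λ yz → ¬xy (N-twin (active L) (deg-u L) (dz xz) xz (N-sym yz)))
        where
        dz : N[ x ] z → deg z ≡ c
        dz (inj₁ refl) = deg-u L
        dz (inj₂ xz)   = deg-N L z xz z≢r

  leaf-avoiding : ∀ k (G : Multigraph n) → Tight c k G → LeafAvoiding G
  -- In a single clique all degrees are `c`, so `z` itself can serve as the attachment vertex.
  leaf-avoiding zero G tight z az with Tightness.other G tight z
  ... | u , au , u≢z = u , z , leaf , inj₁ refl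
    where
    open Multigraph G hiding (Factor; FaultTolerant; Leaf; order; degreeSum)
    leaf : Leaf G c u z
    leaf = record
      { active = au
      ; deg-u  = regular G tight au
      ; edge   = N-≢ (A⊆N G tight au (regular G tight au) az) u≢z
      ; deg-N  = λ y uy _ → regular G tight (e-A (e-sym-pos uy))
      }
  leaf-avoiding (suc k) G tight = Step.leaf-avoiding-step G tight (leaf-avoiding k)

-- Subgraphs without cutvertex

enumerate : {P : Fin n → Set} (P? : ∀ x → Dec (P x)) →
            ∃ λ (f : Fin (count P?) → Fin n) →
              (∀ i j → f i ≡ f j → i ≡ j) × (∀ i → P (f i)) × (∀ x → P x → ∃[ i ] f i ≡ x)
enumerate {zero}      P? = (λ ()) , (λ ()) , (λ ()) , (λ ())
enumerate {suc n} {P} P? with enumerate (P? ∘ suc)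
... | g , g-inj , Pg , g-onto = extend (P? zero)
  where
  extend : (d : Dec (P zero)) → ∃ λ (f : Fin (𝟙 d + count (P? ∘ suc)) → Fin (suc n)) →
           (∀ i j → f i ≡ f j → i ≡ j) × (∀ i → P (f i)) × (∀ x → P x → ∃[ i ] f i ≡ x)
  extend (no ¬p0) = suc ∘ g , (λ i j → g-inj i j ∘ suc-injective) , Pg ,
    λ { zero p → contradiction p ¬p0
      ; (suc x) p → proj₁ (g-onto x p) , cong suc (proj₂ (g-onto x p)) }
  extend (yes p0) = f , f-inj , (λ { zero → p0 ; (suc i) → Pg i }) ,
    λ { zero _ → zero , refl
      ; (suc x) p → suc (proj₁ (g-onto x p)) , cong suc (proj₂ (g-onto x p)) }
    where
    f : Fin (suc (count (P? ∘ suc))) → Fin (suc n)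
    f zero    = zero
    f (suc i) = suc (g i)
    f-inj : ∀ i j → f i ≡ f j → i ≡ j
    f-inj zero    zero    _  = refl
    f-inj (suc i) (suc j) eq = cong suc (g-inj i j (suc-injective eq))

module Biconnected {c : ℕ} (3≤c : 3 ≤ c) {n : ℕ} {G₀ : Graph n} (H : Subgraph G₀)
  (connected : Connected H) (no-cut : NoCutvertex H) where
  open Leaves 3≤c {n}

  Inside : Multigraph n → Set
  Inside G = (∀ x → x ∈ vs H → A x) × (∀ x y → es H x y ≡ true → 1 ≤ e x y)
    where open Multigraph G

  CliqueCover : Multigraph n → Set
  CliqueCover G = ∃ λ (f : Fin (c + 1) → Fin n) →
      (∀ i j → f i ≡ f j → i ≡ j)
    × (∀ i j → i ≢ j → 1 ≤ e (f i) (f j))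
    × (∀ x → x ∈ vs H → ∃[ i ] f i ≡ x)
    where open Multigraph G

  module _ {k : ℕ} (G : Multigraph n) (tight : Tight c k G) where
    open Multigraph G hiding (Factor; FaultTolerant; Leaf; order; degreeSum)
    open Tightness G tight

    N-cover : ∀ {u} → A u → deg u ≡ c → (∀ x → x ∈ vs H → N[ u ] x) → CliqueCover G
    N-cover {u} au du H⊆N = subst Cover (count-N au du)
      (f , f-inj , (λ i j i≢j → N-≢ (N-clique au du (Nf i) (Nf j)) (i≢j ∘ f-inj i j)) , λ x x∈H → f-onto x (H⊆N x x∈H))
      where
      Cover : ℕ → Set
      Cover m = ∃ λ (f : Fin m → Fin n) → (∀ i j → f i ≡ f j → i ≡ j)
        × (∀ i j → i ≢ j → 1 ≤ e (f i) (f j)) × (∀ x → x ∈ vs H → ∃[ i ] f i ≡ x)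
      f      = proj₁ (enumerate N[ u ]?)
      f-inj  = proj₁ (proj₂ (enumerate N[ u ]?))
      Nf     = proj₁ (proj₂ (proj₂ (enumerate N[ u ]?)))
      f-onto = proj₂ (proj₂ (proj₂ (enumerate N[ u ]?)))

    module _ (inside : Inside G) {u r} (L : Leaf G c u r) where

      inner-degree : ∀ y → N[ u ] y → y ≢ r → deg y ≡ c
      inner-degree y (inj₁ refl) _   = deg-u L
      inner-degree y (inj₂ uy)   y≢r = deg-N L y uy y≢r

      inner-step : ∀ {x y} → N[ u ] x → x ≢ r → es H x y ≡ true → N[ u ] y
      inner-step {x} {y} ux x≢r xy =
        N-twin (active L) (deg-u L) (inner-degree x ux x≢r) ux (inj₂ (proj₂ inside x y xy))

      avoiding-stays : ∀ {x z} → WalkAvoid H r x z → N[ u ] x → N[ u ] z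
      avoiding-stays (here _ _)         ux = ux
      avoiding-stays (step _ x≢r xy yz) ux = avoiding-stays yz (inner-step ux x≢r xy)

      -- Inner vertices have no edges out of `N[ u ]`, so the walk can leave only through `r`.
      -- Membership of `r` in `H` is part of being a `Cutvertex`.
      leaving-hits : ∀ {x z} → Walk H x z → N[ u ] x → x ≢ r → ¬ N[ u ] z → r ∈ vs H
      leaving-hits (here _ _)                 ux _   ¬uz = contradiction ux ¬uz
      leaving-hits (step {x} {y} _ _ xy yz) ux x≢r ¬uz with y ≟ r
      ... | yes refl = proj₂ (es-vs H x y xy)
      ... | no y≢r   = leaving-hits yz (inner-step ux x≢r xy) y≢r ¬uz

      -- A vertex `z` of `H` outside `N[ u ]` would be separated from `x` by `r`, making `r` a
      -- cutvertex of `H`.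
      meets-interior⇒⊆N : ∀ {x} → x ∈ vs H → N[ u ] x → x ≢ r → ∀ z → z ∈ vs H → N[ u ] z
      meets-interior⇒⊆N {x} x∈H ux x≢r z z∈H with N[ u ]? z
      ... | yes uz = uz
      ... | no ¬uz = contradiction
        (leaving-hits walk ux x≢r ¬uz , x , z , x∈H , z∈H , x≢r , (λ { refl → ¬uz (inj₂ (edge L)) }) , walk
          , λ avoiding → ¬uz (avoiding-stays avoiding ux))
        (no-cut r)
        where
        walk : Walk H x z
        walk = proj₂ connected x z x∈H z∈H

  module _ {k : ℕ} (G : Multigraph n) (tight : Tight c (suc k) G) (inside : Inside G)
    (IH : ∀ G′ → Tight c k G′ → Inside G′ → CliqueCover G′) {u r : Fin n} (L : Leaf G c u r) where
    open Multigraph G hiding (Factor; FaultTolerant; Leaf; order; degreeSum)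
    open Tightness G tight
    open Contraction 3≤c G ft 2≤order (active L) (deg-u L) (inj₂ (edge L))

    -- The contraction here is onto `r`, so it deletes only vertices that `H` avoids. `H` survives
    -- unchanged, and `e′⇒e` returns the clique found in `G/N` to `G`.
    cover-peeled : (∀ x → x ∈ vs H → h x ≡ x) → CliqueCover G
    cover-peeled fixed = lower (IH G/N (Step.tight-/N G tight (active L) (deg-u L) (inj₂ (edge L))) inside′)
      where
      inside′ : Inside G/N
      inside′ = (λ x x∈H → proj₁ inside x x∈H , fixed x x∈H) , λ x y xy →
        let hx≡x = fixed x (proj₁ (es-vs H x y xy))
            hy≡y = fixed y (proj₂ (es-vs H x y xy))
            1≤xy = proj₂ inside x y xy
        in subst (1 ≤_) (cong₂ e′ hx≡x hy≡y) (≤-trans 1≤xy (e⇒e′ (λ eq → e⇒≢ 1≤xy (trans (sym hx≡x) (trans eq hy≡y)))))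

      lower : CliqueCover G/N → CliqueCover G
      lower (f , f-inj , clique , covers) =
        f , f-inj , (λ i j i≢j → e′⇒e (inner-degree G tight inside L) (clique i j i≢j)) , covers

    cover-leaf : Dec (∃[ x ] (x ∈ vs H × N[ u ] x × x ≢ r)) → CliqueCover G
    cover-leaf (yes (x , x∈H , ux , x≢r)) =
      N-cover G tight (active L) (deg-u L) (meets-interior⇒⊆N G tight inside L x∈H ux x≢r)
    cover-leaf (no misses) = cover-peeled (λ x x∈H → fixed x∈H (N[ u ]? x) (x ≟ r))
      where
      fixed : ∀ {x} → x ∈ vs H → Dec (N[ u ] x) → Dec (x ≡ r) → h x ≡ x
      fixed x∈H (no ¬ux) _          = h-out ¬ux
      fixed x∈H (yes ux) (yes refl) = h-in ux
      fixed x∈H (yes ux) (no x≢r)   = contradiction (_ , x∈H , ux , x≢r) misses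

  clique-cover : ∀ k (G : Multigraph n) → Tight c k G → Inside G → CliqueCover G
  clique-cover zero G tight inside =
    let (u , au , du) = Tightness.minimum-degree G tight
    in N-cover G tight au du (λ x x∈H → A⊆N G tight au du (proj₁ inside x x∈H))
  clique-cover (suc k) G tight inside =
    let (u , r , L , _) = leaf-avoiding (suc k) G tight _ (proj₁ inside _ (proj₂ (proj₁ connected)))
    in cover-leaf G tight inside (clique-cover k) L (any? (λ x → (x ∈? vs H) ×-dec Multigraph.N[_]? G u x ×-dec ¬? (x ≟ r)))

-- A clique is connected without cutvertex, so a block inside one is all of it.

module _ {n : ℕ} (G : Graph n) {m : ℕ} (f : Fin m → Fin n) (f-inj : ∀ i j → f i ≡ f j → i ≡ j)
  (clique : ∀ i j → i ≢ j → adj G (f i) (f j) ≡ true) where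

  Image : Fin n → Set
  Image x = ∃[ i ] f i ≡ x

  image? : ∀ x → Dec (Image x)
  image? x = any? (λ i → f i ≟ x)

  Edge : Fin n → Fin n → Set
  Edge x y = Image x × Image y × x ≢ y

  edge? : ∀ x y → Dec (Edge x y)
  edge? x y = image? x ×-dec image? y ×-dec ¬? (x ≟ y)

  does⇒ : {P : Set} (d : Dec P) → does d ≡ true → P
  does⇒ (yes p) _ = p

  vertices : Subset n
  vertices = tabulate (λ x → does (image? x))

  complete-vs : ∀ {x} → Image x → x ∈ vertices
  complete-vs {x} ix = lookup⇒[]= x _ (trans (lookup∘tabulate _ x) (dec-true (image? x) ix))

  complete-vs⁻¹ : ∀ {x} → x ∈ vertices → Image x
  complete-vs⁻¹ {x} x∈ = does⇒ (image? x) (trans (sym (lookup∘tabulate _ x)) ([]=⇒lookup x∈))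

  complete : Subgraph G
  complete = record
    { vs     = vertices
    ; es     = λ x y → does (edge? x y)
    ; es-sym = λ x y → does-⇔ (mk⇔ flip flip) (edge? x y) (edge? y x)
    ; es-adj = λ x y xy → adjacent (does⇒ (edge? x y) xy)
    ; es-vs  = λ x y xy → complete-vs (proj₁ (does⇒ (edge? x y) xy)) , complete-vs (proj₁ (proj₂ (does⇒ (edge? x y) xy)))
    }
    where
    flip : ∀ {x y} → Edge x y → Edge y x
    flip (ix , iy , x≢y) = iy , ix , x≢y ∘ sym
    adjacent : ∀ {x y} → Edge x y → adj G x y ≡ true
    adjacent ((i , refl) , (j , refl) , fi≢fj) = clique i j (λ { refl → fi≢fj refl })
  complete-walk : (P : Fin n → Set) → ∀ {x y} → x ∈ vs complete → y ∈ vs complete → P x → P y → WalkIn complete P x y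
  complete-walk P {x} {y} x∈ y∈ px py with x ≟ y
  ... | yes refl = here x∈ px
  ... | no x≢y   = step x∈ px (dec-true (edge? x y) (complete-vs⁻¹ x∈ , complete-vs⁻¹ y∈ , x≢y)) (here y∈ py)

  block⊆clique⇒complete : (H : Subgraph G) → IsBlock H → (∀ x → x ∈ vs H → Image x) → IsoComplete H m
  block⊆clique⇒complete H (((x₀ , x₀∈H) , _) , _ , maximal) H⊆K =
    f , f-inj , (λ i → proj₁ K⊑H (f i) (complete-vs (i , refl))) , H⊆K , λ i j → mk⇔ (λ { ij refl → es⇒≢ ij refl })
      (λ i≢j → proj₂ K⊑H (f i) (f j) (dec-true (edge? (f i) (f j)) ((i , refl) , (j , refl) , i≢j ∘ f-inj i j)))
    where
    es⇒≢ : ∀ {x y} → es H x y ≡ true → x ≢ y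
    es⇒≢ {x} xy refl = contradiction (trans (sym (irrefl G x)) (es-adj H x x xy)) λ ()
    H⊑K : H ⊑ complete
    H⊑K = (λ x x∈H → complete-vs (H⊆K x x∈H)) , λ x y xy →
      dec-true (edge? x y) (H⊆K x (proj₁ (es-vs H x y xy)) , H⊆K y (proj₂ (es-vs H x y xy)) , es⇒≢ xy)
    K⊑H : complete ⊑ H
    K⊑H = maximal complete H⊑K
      ((x₀ , complete-vs (H⊆K x₀ x₀∈H)) , λ x y x∈ y∈ → complete-walk (λ _ → ⊤) x∈ y∈ tt tt)
      (λ { v (_ , x , y , x∈ , y∈ , x≢v , y≢v , _ , ¬walk) → ¬walk (complete-walk (_≢ v) x∈ y∈ x≢v y≢v) })

-- Simple graphs as multigraphs

count-image : {m : ℕ} (g : Fin m → Fin n) → (∀ i j → g i ≡ g j → i ≡ j) →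
              {P : Fin n → Set} (P? : ∀ y → Dec (P y)) → (∀ i → P (g i)) → (∀ y → P y → ∃[ i ] g i ≡ y) →
              count P? ≡ m
count-image {n} {m} g g-inj P? Pg onto =
  trans (sum-cong-≗ hits) (trans (∑-comm {n} {m} _) (trans (sum-cong-≗ (λ i → trans
    (sum-cong-≗ (λ y → 𝟙-cong (g i ≟ y) (y ≟ g i) sym sym)) (count-≡ (g i)))) (sum-one m)))
  where
  sum-one : ∀ k → sum {k} (λ _ → 1) ≡ k
  sum-one zero    = refl
  sum-one (suc k) = cong suc (sum-one k)
  hits : ∀ y → 𝟙 (P? y) ≡ sum (λ i → 𝟙 (g i ≟ y))
  hits y with P? y
  ... | no ¬py = sym (sum-zero (λ i → 𝟙-false (g i ≟ y) (λ { refl → ¬py (Pg i) })))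
  ... | yes py with onto y py
  ...   | i , refl = sym (trans (sum-concentrated i (λ j j≢i → 𝟙-false (g j ≟ y) (j≢i ∘ g-inj j i))) (𝟙-true (g i ≟ y) refl))

module Simple {n : ℕ} (G : Graph n) where

  multigraph : Multigraph n
  multigraph = record
    { A     = λ _ → ⊤
    ; A?    = λ _ → yes tt
    ; e     = λ x y → 𝟙 (adj G x y Bool.≟ true)
    ; e-sym = λ x y → cong (λ b → 𝟙 (b Bool.≟ true)) (adj-sym G x y)
    ; e-irr = λ x → cong (λ b → 𝟙 (b Bool.≟ true)) (irrefl G x)
    ; e-A   = λ _ → tt
    }

  order-multigraph : order multigraph ≡ n
  order-multigraph = count-image (λ x → x) (λ _ _ eq → eq) (λ _ → yes tt) (λ _ → tt) (λ y _ → y , refl)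

  upper : Fin n → Fin n → ℕ
  upper i j = if adj G i j ∧ (toℕ i <ᵇ toℕ j) then 1 else 0

  edgeCount-∑ : edgeCount G ≡ sum (λ i → sum (upper i))
  edgeCount-∑ = trans (list-sum (λ i → ListAction.sum (List.map (upper i) (List.allFin n)))) (sum-cong-≗ (λ i → list-sum (upper i)))
    where
    sum-tabulate : ∀ {k} (f : Fin k → ℕ) → ListAction.sum (List.tabulate f) ≡ sum f
    sum-tabulate {zero}  f = refl
    sum-tabulate {suc k} f = cong (f zero +_) (sum-tabulate (f ∘ suc))
    list-sum : (f : Fin n → ℕ) → ListAction.sum (List.map f (List.allFin n)) ≡ sum f
    list-sum f = trans (cong ListAction.sum (map-tabulate (λ i → i) f)) (sum-tabulate f)

  -- By irreflexivity, an adjacent pair has distinct endpoints, so `upper` counts it in one of its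
  -- two orders.
  degreeSum≤2*edgeCount : degreeSum multigraph ≤ edgeCount G + edgeCount G
  degreeSum≤2*edgeCount = ≤-trans (sum-mono (λ i → sum-mono (oriented i))) (≤-reflexive
    (trans (sum-cong-≗ (λ i → ∑-distrib-+ {n} (upper i) (λ j → upper j i))) (trans (∑-distrib-+ {n} _ _)
      (cong₂ _+_ (sym edgeCount-∑) (trans (∑-comm {n} {n} (λ i j → upper j i)) (sym edgeCount-∑))))))
    where
    upper≡1 : ∀ {i j} → adj G i j ≡ true → toℕ i < toℕ j → upper i j ≡ 1
    upper≡1 ij i<j rewrite ij | Equivalence.to T-≡ (<⇒<ᵇ i<j) = refl
    oriented : ∀ i j → 𝟙 (adj G i j Bool.≟ true) ≤ upper i j + upper j i
    oriented i j = 𝟙-≤ (adj G i j Bool.≟ true) (λ ij → by ij (<-cmp (toℕ i) (toℕ j)))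
      where
      by : adj G i j ≡ true → Tri (toℕ i < toℕ j) (toℕ i ≡ toℕ j) (toℕ j < toℕ i) → 1 ≤ upper i j + upper j i
      by ij (tri< i<j _ _) = ≤-trans (≤-reflexive (sym (upper≡1 ij i<j))) (m≤m+n _ _)
      by ij (tri> _ _ j<i) = ≤-trans (≤-reflexive (sym (upper≡1 (trans (adj-sym G j i) ij) j<i))) (m≤n+m _ (upper i j))
      by ij (tri≈ _ i≡j _) with toℕ-injective i≡j
      ... | refl = contradiction (trans (sym (irrefl G i)) ij) λ ()

module _ {p c : ℕ} (G : Graph (p * c + 1)) where
  open Simple G

  module _ {v : Fin (p * c + 1)} (f : Fin p → Fin c → Fin (p * c + 1))
    (f-inj : ∀ a b x y → f a x ≡ f b y → (a ≡ b × x ≡ y)) (f≢v : ∀ a x → f a x ≢ v) where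

    -- The cliques and `v` already use up all `p * c + 1` vertices; a missed `x` would make `g` an
    -- injection from a set with one element more.
    covers : ∀ x → x ≢ v → ∃[ a ] ∃[ i ] f a i ≡ x
    covers x x≢v with any? (λ a → any? (λ i → f a i ≟ x))
    ... | yes found = found
    ... | no ¬found = contradiction (injective⇒≤ (λ {i} {j} → g-inj i j)) (<⇒≱ (≤-reflexive (cong suc (+-comm (p * c) 1))))
      where
      g : Fin (2 + p * c) → Fin (p * c + 1)
      g zero          = v
      g (suc zero)    = x
      g (suc (suc k)) = f (proj₁ (remQuot {p} c k)) (proj₂ (remQuot {p} c k))
      g-inj : ∀ i j → g i ≡ g j → i ≡ j
      g-inj zero          zero          _  = refl
      g-inj zero          (suc zero)    eq = contradiction (sym eq) x≢v
      g-inj zero          (suc (suc _)) eq = contradiction (sym eq) (f≢v _ _)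
      g-inj (suc zero)    zero          eq = contradiction eq x≢v
      g-inj (suc zero)    (suc zero)    _  = refl
      g-inj (suc zero)    (suc (suc _)) eq = contradiction (_ , _ , sym eq) ¬found
      g-inj (suc (suc _)) zero          eq = contradiction eq (f≢v _ _)
      g-inj (suc (suc _)) (suc zero)    eq = contradiction (_ , _ , eq) ¬found
      g-inj (suc (suc k)) (suc (suc l)) eq with f-inj _ _ _ _ eq
      ... | a≡b , i≡j = cong (λ z → suc (suc z)) (trans (sym (combine-remQuot {p} c k))
                          (trans (cong₂ combine a≡b i≡j) (combine-remQuot {p} c l)))

    colour : Fin (p * c + 1) → ℕ
    colour x with any? (λ a → any? (λ i → f a i ≟ x))
    ... | yes (a , _) = toℕ a
    -- By `covers` only `v` gets this default, and `Class` ignores the colour of `v`.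
    ... | no _        = 0

    colour-f : ∀ a i → colour (f a i) ≡ toℕ a
    colour-f a i with any? (λ b → any? (λ j → f b j ≟ f a i))
    ... | yes (b , j , eq) = cong toℕ (proj₁ (f-inj b a j i eq))
    ... | no ¬found        = contradiction (a , i , refl) ¬found

    factor : (∀ a i j → i ≢ j → adj G (f a i) (f a j) ≡ true) → Factor multigraph c v
    factor f-clique = record { col = colour ; class-size = size ; class-clique = clq }
      where
      open Multigraph multigraph using (Class; class?)
      same-clique : ∀ {a i y} → Class colour v (f a i) y → ∃[ j ] f a j ≡ y
      same-clique {a} {i} {y} (_ , y≢v , same) with covers y y≢v
      ... | b , j , refl = j , cong (λ a → f a j) (toℕ-injective (trans (sym (colour-f a i)) (trans (sym same) (colour-f b j))))
      size : ∀ {x} → ⊤ → x ≢ v → count (class? colour v x) ≡ c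
      size {x} _ x≢v with covers x x≢v
      ... | a , i , refl = count-image (f a) (λ j k eq → proj₂ (f-inj a a j k eq)) (class? colour v (f a i))
              (λ j → tt , f≢v a j , trans (colour-f a j) (sym (colour-f a i))) (λ y → same-clique)
      clq : ∀ {x y} → ⊤ → x ≢ v → x ≢ y → Class colour v x y → 1 ≤ 𝟙 (adj G x y Bool.≟ true)
      clq {x} {y} _ x≢v x≢y cl with covers x x≢v
      ... | a , i , refl with same-clique cl
      ... | j , refl = ≤-reflexive (sym (𝟙-true (adj G x y Bool.≟ true) (f-clique a i j (λ { refl → x≢y refl }))))

  FT⇒FaultTolerant : FT 1 p c G → FaultTolerant multigraph c
  FT⇒FaultTolerant ft v _ with ft ⁅ v ⁆ (≤-reflexive (∣⁅x⁆∣≡1 v))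
  ... | f , f-inj , f∉ , f-clique =
    factor f f-inj (λ a i eq → f∉ a i (subst (_∈ ⁅ v ⁆) (sym eq) (x∈⁅x⁆ v))) f-clique

-- The binomial bound and the conclusion.

2*[n+1]C2 : ∀ n → suc n C 2 + suc n C 2 ≡ suc n * n
2*[n+1]C2 zero    = refl
2*[n+1]C2 (suc n) = trans (cong (λ z → z + z) (trans (sym (nCk+nC[k+1]≡[n+1]C[k+1] (suc n) 1)) (cong (_+ suc n C 2) (nC1≡n (suc n)))))
  (trans (regroup (suc n) (suc n C 2)) (trans (cong (suc n + suc n +_) (2*[n+1]C2 n)) (arith n)))
  where
  regroup : ∀ a b → (a + b) + (a + b) ≡ a + a + (b + b)
  regroup = solve-∀
  arith : ∀ n → suc n + suc n + suc n * n ≡ suc (suc n) * suc n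
  arith = solve-∀

theorem1 : (p c : ℕ) → 1 ≤ p → 3 ≤ c → (G : Graph (p * c + 1)) → FT 1 p c G → edgeCount G ≤ ((c + 1) C 2) * p → (H : Subgraph G) → IsBlock H → IsoComplete H (c + 1)
theorem1 (suc k) c 1≤p 3≤c G ft few H block@(connected , no-cut , _) =
  block⊆clique⇒complete G (proj₁ cover) (proj₁ (proj₂ cover))
    (λ i j i≢j → 𝟙-pos (proj₁ (proj₂ (proj₂ cover)) i j i≢j)) H block (proj₂ (proj₂ (proj₂ cover)))
  where
  open Simple G
  open Biconnected 3≤c H connected no-cut

  double : ∀ {a b} K → K + K ≡ b → a ≤ K * suc k → a + a ≤ suc k * b
  double K refl a≤ = ≤-trans (+-mono-≤ a≤ a≤) (≤-reflexive (arith K (suc k)))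
    where
    arith : ∀ a b → a * b + a * b ≡ b * (a + a)
    arith = solve-∀

  tight : Tight c k multigraph
  tight = record
    { ft          = FT⇒FaultTolerant {suc k} G ft
    ; order-≡     = order-multigraph
    -- Doubling the bound on the edges turns the binomial coefficient into `(c + 1) * c`.
    ; degreeSum-≤ = ≤-trans degreeSum≤2*edgeCount (double ((c + 1) C 2)
        (subst (λ m → m C 2 + m C 2 ≡ m * c) (+-comm 1 c) (2*[n+1]C2 c)) few)
    }

  cover : CliqueCover multigraph
  cover = clique-cover k multigraph tight
    ((λ _ _ → tt) , λ x y xy → ≤-reflexive (sym (𝟙-true (adj G x y Bool.≟ true) (es-adj H x y xy))))
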